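{- Let $k\ge 2$ and $n>2k$ be integers such that $k$ does not divide $n$. Then $$\rho(\mathrm{PX}(n,k))=\begin{cases}\lceil n/k\rceil+1, & \text{if } n\equiv -1\pmod k,\\ \lceil n/k\rceil, & \text{if } n\not\equiv -1\pmod k.\end{cases}$$
   Context: For integers $n\ge 3$ and $1\le k<n$, the Praeger–Xu graph $\mathrm{PX}(n,k)$ is the simple graph with vertex set $\mathbb Z_n\times\mathbb Z_2^k$; a vertex is written $(i,x)$ with $x=x_0x_1\cdots x_{k-1}$ a bitstring of length $k$. Two vertices $(i,x)$ and $(j,y)$ are adjacent if and only if (after possibly swapping the two vertices) $j=i+1$ in $\mathbb Z_n$ and $x=az_1\cdots z_{k-1}$, $y=z_1\cdots z_{k-1}b$ for some bits $a,b,z_1,\dots,z_{k-1}\in\mathbb Z_2$. For a graph $G$ admitting a 2-coloring of its vertices preserved (class-wise) only by the identity automorphism, $\rho(G)$ denotes the minimum size of a color class over all such 2-colorings. -}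

module Defs where

open import Data.Nat using (ℕ; zero; suc; _+_; _∸_; _/_; _≤_)
open import Data.Fin using (Fin; toℕ)
open import Data.Vec using (Vec; _∷_; _∷ʳ_)
open import Data.Bool using (Bool)
open import Data.Product using (_×_; Σ; ∃-syntax; _,_)
open import Data.Sum using (_⊎_)
open import Data.Empty using (⊥)
open import Relation.Binary.PropositionalEquality using (_≡_)
open import Function.Bundles using (_↔_; Inverse)

record Graph : Set₁ where
  field
    V   : Set
    Adj : V → V → Set
open Graph public

SuccMod : (n : ℕ) → Fin n → Fin n → Set
SuccMod n i j = (toℕ j ≡ suc (toℕ i)) ⊎ ((suc (toℕ i) ≡ n) × (toℕ j ≡ 0))

Shift : {k : ℕ} → Vec Bool k → Vec Bool k → Set
Shift {zero}  x y = ⊥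
Shift {suc m} x y =
  ∃[ a ] ∃[ b ] ∃[ z ] ((x ≡ a ∷ z) × (y ≡ z ∷ʳ b))

PXVertex : ℕ → ℕ → Set
PXVertex n k = Fin n × Vec Bool k

PXStep : (n k : ℕ) → PXVertex n k → PXVertex n k → Set
PXStep n k (i , x) (j , y) = SuccMod n i j × Shift x y

PX : ℕ → ℕ → Graph
PX n k = record
  { V   = PXVertex n k
  ; Adj = λ u v → PXStep n k u v ⊎ PXStep n k v u }

record Automorphism (G : Graph) : Set where
  field
    perm     : V G ↔ V G
    preserve : ∀ u v → (Adj G u v → Adj G (Inverse.to perm u) (Inverse.to perm v))
                     × (Adj G (Inverse.to perm u) (Inverse.to perm v) → Adj G u v)
open Automorphism public

Coloring : Graph → Set
Coloring G = V G → Bool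

Distinguishing : (G : Graph) → Coloring G → Set
Distinguishing G c =
  (σ : Automorphism G) → (∀ v → c (Inverse.to (perm σ) v) ≡ c v) →
  ∀ v → Inverse.to (perm σ) v ≡ v

ClassSize : (G : Graph) → Coloring G → Bool → ℕ → Set
ClassSize G c b m = Fin m ↔ Σ (V G) (λ v → c v ≡ b)

IsRho : Graph → ℕ → Set
IsRho G m =
  (Σ (Coloring G) λ c → Distinguishing G c × Σ Bool λ b → ClassSize G c b m)
  × (∀ (c : Coloring G) → Distinguishing G c → ∀ (b : Bool) (s : ℕ) →
       ClassSize G c b s → m ≤ s)

⌈_/_⌉ : ℕ → ℕ → ℕ
⌈ n / zero ⌉ = 0
⌈ n / suc k ⌉ = (n + k) / suc k

{-# OPTIONS --safe #-}

-- View the vertex (i , x) as a word x written on the window i, …, i + k - 1 of ℤₙ; then toggling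
-- the bit at a position of ℤₙ, wherever it is read, is an automorphism.
--
-- Lower bound: the windows of a class of a distinguishing colouring must cover ℤₙ, since the toggle
-- at an uncovered position fixes the class pointwise; hence the class has at least ⌈n/k⌉ vertices.
-- If n + 1 = M k and there are only M windows, they meet in exactly one position, so they start at
-- P, P + k, …, P + (M - 1) k, and a reflection followed by suitable toggles preserves the class.
--
-- Upper bound: n + r = M k with 0 < r < k.  No directed path of length two lies on a 4-cycle, so an
-- automorphism preserves or reverses all directed edges; up to a reflection it is then a rotation
-- of the layers combined with a bit permutation at each position.  Take the vertices
-- (0 , 10…0), (k , 0…0), …, ((M - 1) k , 0…0), and for r = 1 also (0 , 0…0).  A rotation preserving
-- this class is trivial because r is not a multiple of k; a reflection would have to exchange the two
-- overlapping windows, which the single 1 prevents for r ≥ 2 and the additional vertex for r = 1.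

module Submission where

open import Defs
open import Data.Nat hiding (_≟_)
open import Data.Nat.Properties hiding (_≟_)
open import Data.Nat.DivMod
open import Data.Nat.Divisibility
open import Data.Nat.Tactic.RingSolver using (solve-∀)
open import Data.Fin using (Fin; zero; suc; toℕ; fromℕ<; punchIn; punchOut; combine; remQuot)
open import Data.Fin.Properties using (toℕ-fromℕ<; toℕ<n; toℕ-injective; any?; injective⇒≤; pigeonhole;
  punchIn-punchOut; punchOut-injective; remQuot-combine; combine-remQuot)
  renaming (_≟_ to _≟ᶠ_; <⇒≢ to <⇒≢ᶠ)
open import Data.Vec using (Vec; []; _∷_; _∷ʳ_)
open import Data.Vec.Properties using () renaming (≡-dec to ≡-decᵛ)
open import Data.Bool using (Bool; true; false; not; _xor_)
open import Data.Bool.Properties using (¬-not; not-¬; xor-assoc; xor-comm; xor-same; xor-identityʳ)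
  renaming (_≟_ to _≟ᵇ_)
open import Data.Product hiding (map)
open import Data.Product.Properties using () renaming (≡-dec to ≡-decˣ)
open import Data.Sum
open import Data.Empty using (⊥; ⊥-elim)
open import Relation.Nullary
open import Relation.Nullary.Decidable using (dec-true; dec-false)
open import Relation.Binary.Definitions using (DecidableEquality)
open import Relation.Binary.PropositionalEquality
open import Axiom.UniquenessOfIdentityProofs using (module Decidable⇒UIP)
open import Function.Base using (_∘_; id)
open import Function.Bundles using (Inverse; mk↔ₛ′)
open import Function.Definitions using (Injective; StrictlySurjective)

-- Arithmetic in ℤₙ through natural number representatives.

module Cyclic (N : ℕ) where

  n : ℕ
  n = suc N

  -- Opaque, so that unification can read u off at u.
  opaque
    at : ℕ → Fin n
    at u = fromℕ< (m%n<n u n)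

    toℕ-at : ∀ u → toℕ (at u) ≡ u % n
    toℕ-at u = toℕ-fromℕ< (m%n<n u n)

  at-% : ∀ u v → u % n ≡ v % n → at u ≡ at v
  at-% u v e = toℕ-injective (trans (toℕ-at u) (trans e (sym (toℕ-at v))))

  %-at : ∀ {u v} → at u ≡ at v → u % n ≡ v % n
  %-at {u} {v} e = trans (sym (toℕ-at u)) (trans (cong toℕ e) (toℕ-at v))

  toℕ-at-< : ∀ {u} → u < n → toℕ (at u) ≡ u
  toℕ-at-< {u} u<n = trans (toℕ-at u) (m<n⇒m%n≡m u<n)

  at-toℕ : ∀ i → at (toℕ i) ≡ i
  at-toℕ i = toℕ-injective (toℕ-at-< (toℕ<n i))

  at-inj : ∀ {u v} → u < n → v < n → at u ≡ at v → u ≡ v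
  at-inj u<n v<n e = trans (sym (toℕ-at-< u<n)) (trans (cong toℕ e) (toℕ-at-< v<n))

  at-+*n : ∀ u w → at (u + w * n) ≡ at u
  at-+*n u w = at-% (u + w * n) u ([m+kn]%n≡m%n u w n)

  at-+n : ∀ u → at (u + n) ≡ at u
  at-+n u = at-% (u + n) u ([m+n]%n≡m%n u n)

  at-+-cong : ∀ {u u′ v v′} → at u ≡ at u′ → at v ≡ at v′ → at (u + v) ≡ at (u′ + v′)
  at-+-cong {u} {u′} {v} {v′} e f = at-% (u + v) (u′ + v′)
    (trans (%-distribˡ-+ u v n)
      (trans (cong₂ (λ a b → (a + b) % n) (%-at {u} {u′} e) (%-at {v} {v′} f))
        (sym (%-distribˡ-+ u′ v′ n))))

  -- As `n = suc N`, the number `N` is -1 modulo `n`, so adding `N * w` undoes adding `w`. Multiples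
  -- of `N` stand for negatives in the same way further on.
  at-+-cancelˡ : ∀ w {u v} → at (w + u) ≡ at (w + v) → at u ≡ at v
  at-+-cancelˡ w {u} {v} e =
    trans (sym (shift u)) (trans (at-+-cong {N * w} {N * w} {w + u} {w + v} refl e) (shift v))
    where
    regroup : ∀ M w u → M * w + (w + u) ≡ u + w * suc M
    regroup = solve-∀
    shift : ∀ u → at (N * w + (w + u)) ≡ at u
    shift u = trans (cong at (regroup N w u)) (at-+*n u w)

  at-+-cancelʳ : ∀ w {u v} → at (u + w) ≡ at (v + w) → at u ≡ at v
  at-+-cancelʳ w {u} {v} e = at-+-cancelˡ w
    (trans (cong at (+-comm w u)) (trans e (cong at (+-comm v w))))

  at-+-absorb : ∀ u {d} → d < n → at (u + d) ≡ at u → d ≡ 0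
  at-+-absorb u d<n e = at-inj d<n z<s
    (at-+-cancelˡ u (trans e (cong at (sym (+-identityʳ u)))))

  at-toℕ-at-+ : ∀ u v → at (toℕ (at u) + v) ≡ at (u + v)
  at-toℕ-at-+ u v = at-+-cong {toℕ (at u)} {u} {v} {v} (at-toℕ (at u)) refl

  next : Fin n → Fin n
  next i = at (suc (toℕ i))

  next-at : ∀ u → next (at u) ≡ at (suc u)
  next-at u = at-+-cong {1} {1} {toℕ (at u)} {u} refl (at-toℕ (at u))

  next-injective : ∀ {i j} → next i ≡ next j → i ≡ j
  next-injective {i} {j} e = trans (sym (at-toℕ i)) (trans (at-+-cancelˡ 1 e) (at-toℕ j))

  SuccMod⇒next : ∀ {i j} → SuccMod n i j → next i ≡ j
  SuccMod⇒next {i} {j} (inj₁ e) = trans (cong at (sym e)) (at-toℕ j)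
  SuccMod⇒next {i} {j} (inj₂ (e , f)) =
    trans (cong at e) (trans (at-+n 0) (trans (cong at (sym f)) (at-toℕ j)))

  next⇒SuccMod : ∀ {i j} → next i ≡ j → SuccMod n i j
  next⇒SuccMod {i} refl with m≤n⇒m<n∨m≡n (toℕ<n i)
  ... | inj₁ lt = inj₁ (toℕ-at-< lt)
  ... | inj₂ eq = inj₂ (eq , trans (cong toℕ (trans (cong at eq) (at-+n 0))) (toℕ-at-< {0} z<s))

  next²≢ : 2 < n → ∀ {i} → next (next i) ≢ i
  next²≢ 2<n {i} e with at-+-absorb (toℕ i) {2} 2<n
    (trans (cong at (+-comm (toℕ i) 2)) (trans (sym (next-at (suc (toℕ i)))) (trans e (sym (at-toℕ i)))))
  ... | ()

  next⁴≢ : 4 < n → ∀ {i} → next (next (next (next i))) ≢ i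
  next⁴≢ 4<n {i} e with at-+-absorb (toℕ i) {4} 4<n
    (trans (cong at (+-comm (toℕ i) 4))
      (trans (sym (trans (cong (next ∘ next) (next-at (suc (toℕ i))))
                   (trans (cong next (next-at (2 + toℕ i))) (next-at (3 + toℕ i)))))
        (trans e (sym (at-toℕ i)))))
  ... | ()

-- Bitstrings read place by place.

bit : ∀ {k} → Vec Bool k → ℕ → Bool
-- The default `false` continues a word by zeros for ever, so a window sliding along it ends at the
-- zero word.
bit []      _       = false
bit (b ∷ x) zero    = b
bit (b ∷ x) (suc t) = bit x t

bit-ext : ∀ {k} (x y : Vec Bool k) → (∀ t → t < k → bit x t ≡ bit y t) → x ≡ y
bit-ext []      []      e = refl
bit-ext (a ∷ x) (b ∷ y) e = cong₂ _∷_ (e 0 z<s) (bit-ext x y (λ t t<k → e (suc t) (s<s t<k)))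

window : (k : ℕ) → (ℕ → Bool) → Vec Bool k
window zero    f = []
window (suc k) f = f 0 ∷ window k (f ∘ suc)

bit-window : ∀ k f {t} → t < k → bit (window k f) t ≡ f t
bit-window (suc k) f {zero}  _         = refl
bit-window (suc k) f {suc t} (s≤s t<k) = bit-window k (f ∘ suc) t<k

window-cong : ∀ k {f g} → (∀ t → t < k → f t ≡ g t) → window k f ≡ window k g
window-cong zero    e = refl
window-cong (suc k) e = cong₂ _∷_ (e 0 z<s) (window-cong k (λ t t<k → e (suc t) (s<s t<k)))

window-bit : ∀ {k} (x : Vec Bool k) → window k (bit x) ≡ x
window-bit []      = refl
window-bit (b ∷ x) = cong (b ∷_) (window-bit x)

bit-≥ : ∀ {k} (x : Vec Bool k) {t} → k ≤ t → bit x t ≡ false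
bit-≥ []      _         = refl
bit-≥ (b ∷ x) (s≤s k≤t) = bit-≥ x k≤t

bit-∷ʳ-< : ∀ {m} (z : Vec Bool m) b {t} → t < m → bit (z ∷ʳ b) t ≡ bit z t
bit-∷ʳ-< (a ∷ z) b {zero}  _         = refl
bit-∷ʳ-< (a ∷ z) b {suc t} (s≤s t<m) = bit-∷ʳ-< z b t<m

bit-∷ʳ-≡ : ∀ {m} (z : Vec Bool m) b → bit (z ∷ʳ b) m ≡ b
bit-∷ʳ-≡ []      b = refl
bit-∷ʳ-≡ (a ∷ z) b = bit-∷ʳ-≡ z b

Shift⇒bit : ∀ {m} {x y : Vec Bool (suc m)} → Shift x y → ∀ {t} → t < m → bit y t ≡ bit x (suc t)
Shift⇒bit (a , b , z , refl , refl) t<m = bit-∷ʳ-< z b t<m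

-- A shift only ties the `m` common bits; the bit leaving `x` and the bit entering `y` are free and
-- serve as witnesses.
bit⇒Shift : ∀ {m} {x y : Vec Bool (suc m)} → (∀ {t} → t < m → bit y t ≡ bit x (suc t)) → Shift x y
bit⇒Shift {m} {a ∷ z} {y} e = a , bit y m , z , refl , bit-ext y (z ∷ʳ bit y m) agree
  where
  agree : ∀ t → t < suc m → bit y t ≡ bit (z ∷ʳ bit y m) t
  agree t (s≤s t≤m) with m≤n⇒m<n∨m≡n t≤m
  ... | inj₁ t<m  = trans (e t<m) (sym (bit-∷ʳ-< z (bit y m) t<m))
  ... | inj₂ refl = sym (bit-∷ʳ-≡ z (bit y m))

zeros : ∀ {k} → Vec Bool k
zeros {k} = window k (λ _ → false)

bit-zeros : ∀ {k} t → bit (zeros {k}) t ≡ false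
bit-zeros {zero}  t       = refl
bit-zeros {suc k} zero    = refl
bit-zeros {suc k} (suc t) = bit-zeros {k} t

-- Steps, walks and 4-cycles in the Praeger-Xu graph.

module PraegerXu (N m : ℕ) where

  open Cyclic N public

  k : ℕ
  k = suc m

  Vertex : Set
  Vertex = PXVertex n k

  Step : Vertex → Vertex → Set
  Step = PXStep n k

  mkStep : ∀ {u v : Vertex} → next (proj₁ u) ≡ proj₁ v →
    (∀ {t} → t < m → bit (proj₂ v) t ≡ bit (proj₂ u) (suc t)) → Step u v
  mkStep e f = next⇒SuccMod e , bit⇒Shift f

  Step⇒next : ∀ {u v} → Step u v → next (proj₁ u) ≡ proj₁ v
  Step⇒next (s , _) = SuccMod⇒next s

  Step⇒bit : ∀ {u v} → Step u v → ∀ {t} → t < m → bit (proj₂ v) t ≡ bit (proj₂ u) (suc t)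
  Step⇒bit (_ , s) = Shift⇒bit s

  -- A window of length `k` slides along an infinite word from layer `u`. With a word continued by
  -- zeros, the walk forgets where it came from after `k` steps (`walk-zeros`).
  walk : ℕ → (ℕ → Bool) → ℕ → Vertex
  walk u f j = at (u + j) , window k (λ t → f (j + t))

  walk-step : ∀ u f j → Step (walk u f j) (walk u f (suc j))
  walk-step u f j = mkStep (trans (next-at (u + j)) (cong at (sym (+-suc u j)))) λ {t} t<m →
    trans (bit-window k (λ t → f (suc j + t)) (m<n⇒m<1+n t<m))
      (trans (cong f (sym (+-suc j t))) (sym (bit-window k (λ t → f (j + t)) (s<s t<m))))

  walk-start : ∀ u (x : Vec Bool k) → walk u (bit x) 0 ≡ (at u , x)
  walk-start u x = cong₂ _,_ (cong at (+-identityʳ u)) (window-bit x)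

  walk-zeros : ∀ u (x : Vec Bool k) {j} → k ≤ j → walk u (bit x) j ≡ (at (u + j) , zeros)
  walk-zeros u x {j} k≤j = cong₂ _,_ refl
    (window-cong k (λ t _ → bit-≥ x (≤-trans k≤j (m≤m+n j t))))

  lift : ∀ (v : Vertex) → v ≡ (at (toℕ (proj₁ v)) , proj₂ v)
  lift (i , x) = cong (λ i → i , x) (sym (at-toℕ i))

  -- Between two vertices two layers apart there is at most one vertex, since k ≥ 2.
  midpoint-unique : 1 ≤ m → ∀ {b c d a} → Step b c → Step c a → Step b d → Step d a → c ≡ d
  midpoint-unique 1≤m {b} {c} {d} {a} bc ca bd da =
    cong₂ _,_ (trans (sym (Step⇒next bc)) (Step⇒next bd)) (bit-ext (proj₂ c) (proj₂ d) (agree 1≤m))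
    where
    agree : 1 ≤ m → ∀ t → t < suc m → bit (proj₂ c) t ≡ bit (proj₂ d) t
    agree _ t (s≤s t≤m) with m≤n⇒m<n∨m≡n t≤m
    ... | inj₁ t<m = trans (Step⇒bit bc t<m) (sym (Step⇒bit bd t<m))
    agree (s≤s _) t@(suc t′) _ | inj₂ refl =
      trans (sym (Step⇒bit ca (n<1+n t′))) (Step⇒bit da (n<1+n t′))

  Adj′ : Vertex → Vertex → Set
  Adj′ = Adj (PX n k)

  -- The two edges at `d` may point either way. If b → d → a, midpoints are unique; if a → d → b, a
  -- directed 4-cycle would advance the layer by 4; otherwise `a` and `b` would share a layer
  -- although they are two steps apart.
  no-square : 1 ≤ m → 4 < n → ∀ {b c a d} → Step b c → Step c a → Adj′ d a → Adj′ d b → c ≡ d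
  no-square 1≤m 4<n bc ca (inj₁ da) (inj₂ bd) = midpoint-unique 1≤m bc ca bd da
  no-square 1≤m 4<n {b} {c} {a} {d} bc ca (inj₂ ad) (inj₁ db) = ⊥-elim (next⁴≢ 4<n {proj₁ b}
    (trans (cong (next ∘ next ∘ next) (Step⇒next bc))
      (trans (cong (next ∘ next) (Step⇒next ca)) (trans (cong next (Step⇒next ad)) (Step⇒next db)))))
  no-square 1≤m 4<n {b} bc ca (inj₁ da) (inj₁ db) = ⊥-elim (next²≢ (<-trans (s<s (s<s z<s)) 4<n) {proj₁ b}
    (trans (cong next (Step⇒next bc)) (trans (Step⇒next ca) (trans (sym (Step⇒next da)) (Step⇒next db)))))
  no-square 1≤m 4<n {b} bc ca (inj₂ ad) (inj₂ bd) = ⊥-elim (next²≢ (<-trans (s<s (s<s z<s)) 4<n) {proj₁ b}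
    (next-injective (trans (cong (next ∘ next) (Step⇒next bc))
      (trans (cong next (Step⇒next ca)) (trans (Step⇒next ad) (sym (Step⇒next bd)))))))

  Step-asym : 2 < n → ∀ {u v} → Step u v → ¬ Step v u
  Step-asym 2<n {u} uv vu = next²≢ 2<n (trans (cong next (Step⇒next uv)) (Step⇒next vu))

  -- Toggling the last (resp. first) bit keeps the in-neighbours (resp. out-neighbours).
  otherOut : ∀ {a v} → Step a v →
    Σ Vertex λ y → y ≢ v × (∀ {a′} → Step a′ v → Step a′ y)
  otherOut {a} {i , x} (_ , _ , b , z , _ , refl) = (i , z ∷ʳ not b) ,
    (λ e → not-¬ refl (trans (sym (bit-∷ʳ-≡ z b))
      (trans (cong (λ v → bit (proj₂ v) m) (sym e)) (bit-∷ʳ-≡ z (not b))))) ,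
    λ s → mkStep (Step⇒next s) λ t<m →
      trans (trans (bit-∷ʳ-< z (not b) t<m) (sym (bit-∷ʳ-< z b t<m))) (Step⇒bit s t<m)

  otherIn : ∀ (v : Vertex) → Σ Vertex λ y → y ≢ v × (∀ {a′} → Step v a′ → Step y a′)
  otherIn (i , b ∷ z) = (i , not b ∷ z) ,
    (λ e → not-¬ refl (cong (λ v → bit (proj₂ v) 0) (sym e))) ,
    λ s → mkStep (Step⇒next s) (Step⇒bit s)

  -- Automorphisms preserve all directions or reverse all of them.

  StepPreserving : (Vertex → Vertex) → Set
  StepPreserving g = ∀ {u v} → Step u v → Step (g u) (g v)

  StepReversing : (Vertex → Vertex) → Set
  StepReversing g = ∀ {u v} → Step u v → Step (g v) (g u)

  module Direction (1≤m : 1 ≤ m) (4<n : 4 < n) (σ : Automorphism (PX n k)) where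

    open Inverse (perm σ) renaming (to to f; from to f⁻¹)

    ff⁻¹ : ∀ y → f (f⁻¹ y) ≡ y
    ff⁻¹ y = inverseˡ refl

    step-adj : ∀ {u v} → Step u v → Adj′ (f u) (f v)
    step-adj {u} {v} s = proj₁ (preserve σ u v) (inj₁ s)

    -- A directed path u → v → w lies on no 4-cycle, so its image cannot have the
    -- shape → ← or ← →, which does lie on a 4-cycle.
    private
      no-turn : ∀ {u v w} → Step u v → Step v w →
        ∀ y → y ≢ f v → Adj′ y (f u) → Adj′ y (f w) → ⊥
      no-turn {u} {v} {w} uv vw y y≢ yu yw = y≢ (trans (sym (ff⁻¹ y)) (cong f
        (sym (no-square 1≤m 4<n uv vw (pull w yw) (pull u yu)))))
        where
        pull : ∀ u → Adj′ y (f u) → Adj′ (f⁻¹ y) u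
        pull u a = proj₂ (preserve σ (f⁻¹ y) u) (subst (λ y → Adj′ y (f u)) (sym (ff⁻¹ y)) a)

    forward : ∀ {u v w} → Step u v → Step v w → Step (f u) (f v) → Step (f v) (f w)
    forward uv vw p with step-adj vw
    ... | inj₁ s = s
    ... | inj₂ s = let y , y≢ , out = otherOut p in
                   ⊥-elim (no-turn uv vw y y≢ (inj₂ (out p)) (inj₂ (out s)))

    backward : ∀ {u v w} → Step u v → Step v w → Step (f v) (f u) → Step (f w) (f v)
    backward {v = v} uv vw p with step-adj vw
    ... | inj₂ s = s
    ... | inj₁ s = let y , y≢ , out = otherIn (f v) in
                   ⊥-elim (no-turn uv vw y y≢ (inj₁ (out p)) (inj₁ (out s)))

    module _ (u : ℕ) (g : ℕ → Bool) where

      forward-walk : Step (f (walk u g 0)) (f (walk u g 1)) →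
        ∀ j → Step (f (walk u g j)) (f (walk u g (suc j)))
      forward-walk p zero    = p
      forward-walk p (suc j) = forward (walk-step u g j) (walk-step u g (suc j)) (forward-walk p j)

      backward-walk : Step (f (walk u g 1)) (f (walk u g 0)) →
        ∀ j → Step (f (walk u g (suc j))) (f (walk u g j))
      backward-walk p zero    = p
      backward-walk p (suc j) = backward (walk-step u g j) (walk-step u g (suc j)) (backward-walk p j)

    private
      origin : ℕ → Vertex
      origin = walk 0 (λ _ → false)

      -- Every step starts a walk that ends in the walk through the all-zero vertices.
      walk-of-step : ∀ {v w} → Step v w → Σ (ℕ → Bool) λ g →
        walk (toℕ (proj₁ v)) g 0 ≡ v × walk (toℕ (proj₁ v)) g 1 ≡ w ×
        (∀ j → suc k ≤ j → walk (toℕ (proj₁ v)) g j ≡ origin (toℕ (proj₁ v) + j))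
      walk-of-step {i , x} {j , y} (s , a , b , z , refl , refl) = bit ((a ∷ z) ∷ʳ b) ,
        cong₂ _,_ (trans (cong at (+-identityʳ (toℕ i))) (at-toℕ i))
          (trans (window-cong k (λ t t<k → bit-∷ʳ-< (a ∷ z) b t<k)) (window-bit (a ∷ z))) ,
        cong₂ _,_ (trans (cong at (+-comm (toℕ i) 1)) (SuccMod⇒next s)) (window-bit (z ∷ʳ b)) ,
        λ j k<j → cong₂ _,_ refl
          (window-cong k (λ t _ → bit-≥ ((a ∷ z) ∷ʳ b) (≤-trans k<j (m≤m+n j t))))

    -- A single reversed step would make the whole walk it starts reversed. After `suc k` steps that
    -- walk runs through the zero vertices, where the walk from `origin 0` is already known to go
    -- forward.
    all-forward : Step (f (origin 0)) (f (origin 1)) → StepPreserving f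
    all-forward p {v} {w} s with step-adj s
    ... | inj₁ q = q
    ... | inj₂ q with g , e₀ , e₁ , end ← walk-of-step s = ⊥-elim (Step-asym (<-trans (s<s (s<s z<s)) 4<n)
      (forward-walk 0 (λ _ → false) p L)
      (subst₂ Step (cong f (trans (end (suc (suc k)) (n≤1+n _)) (cong origin (+-suc u (suc k)))))
        (cong f (end (suc k) ≤-refl)) (backward-walk u g (subst₂ Step (cong f (sym e₁)) (cong f (sym e₀)) q) (suc k))))
      where
      u = toℕ (proj₁ v)
      L = u + suc k

    all-backward : Step (f (origin 1)) (f (origin 0)) → StepReversing f
    all-backward p {v} {w} s with step-adj s
    ... | inj₂ q = q
    ... | inj₁ q with g , e₀ , e₁ , end ← walk-of-step s = ⊥-elim (Step-asym (<-trans (s<s (s<s z<s)) 4<n)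
      (backward-walk 0 (λ _ → false) p L)
      (subst₂ Step (cong f (end (suc k) ≤-refl))
        (cong f (trans (end (suc (suc k)) (n≤1+n _)) (cong origin (+-suc u (suc k)))))
        (forward-walk u g (subst₂ Step (cong f (sym e₀)) (cong f (sym e₁)) q) (suc k))))
      where
      u = toℕ (proj₁ v)
      L = u + suc k

    direction : StepPreserving f ⊎ StepReversing f
    direction with step-adj (walk-step 0 (λ _ → false) 0)
    ... | inj₁ p = inj₁ (all-forward p)
    ... | inj₂ p = inj₂ (all-backward p)

-- Reflections, and the shape of step-preserving maps.

module Symmetries (N m : ℕ) where

  open PraegerXu N m public

  -- The layer `c + N * toℕ i` is c - i, and the word is reversed, so position p of ℤₙ goes to c + m
  -- - p.
  reflect : ℕ → Vertex → Vertex
  reflect c (i , x) = at (c + N * toℕ i) , window k (λ t → bit x (m ∸ t))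

  reflect-bit : ∀ c (v : Vertex) {t} → t < k → bit (proj₂ (reflect c v)) t ≡ bit (proj₂ v) (m ∸ t)
  reflect-bit c (i , x) t<k = bit-window k (λ t → bit x (m ∸ t)) t<k

  -- Pins down the reflected layer by a sum, so that later arguments need only cancellation.
  reflect-layer : ∀ c (v : Vertex) → at (toℕ (proj₁ v) + toℕ (proj₁ (reflect c v))) ≡ at c
  reflect-layer c (i , x) = trans (at-+-cong {toℕ i} refl (at-toℕ (at (c + N * toℕ i))))
    (trans (cong at (regroup N c (toℕ i))) (at-+*n c (toℕ i)))
    where
    regroup : ∀ N c i → i + (c + N * i) ≡ c + i * suc N
    regroup = solve-∀

  reflect-reversing : ∀ c → StepReversing (reflect c)
  reflect-reversing c {u} {v} s = mkStep
    (trans (at-+-cancelˡ i (trans (cong at (+-suc i j′)) (trans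
        (at-+-cong {suc i} {toℕ (proj₁ v)} {j′} {j′} (trans (Step⇒next s) (sym (at-toℕ (proj₁ v)))) refl)
        (trans (reflect-layer c v) (sym (reflect-layer c u))))))
      (at-toℕ (proj₁ (reflect c u))))
    λ {t} t<m → trans (reflect-bit c u (m<n⇒m<1+n t<m)) (trans (cong (bit (proj₂ u)) (m∸t t<m))
      (trans (sym (Step⇒bit s (m∸1+t<m t<m))) (sym (reflect-bit c v (s<s t<m)))))
    where
    i  = toℕ (proj₁ u)
    j′ = toℕ (proj₁ (reflect c v))
    m∸t : ∀ {m t} → t < m → m ∸ t ≡ suc (m ∸ suc t)
    m∸t {suc m} (s≤s t≤m) = +-∸-assoc 1 t≤m
    m∸1+t<m : ∀ {m t} → t < m → m ∸ suc t < m
    m∸1+t<m {suc m} {t} _ = s≤s (m∸n≤m m t)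

  reflect-involutive : ∀ c (v : Vertex) → reflect c (reflect c v) ≡ v
  reflect-involutive c v = cong₂ _,_
    (trans (sym (at-toℕ i″)) (trans (at-+-cancelˡ i′ (trans (reflect-layer c (reflect c v))
        (trans (sym (reflect-layer c v)) (cong at (+-comm i i′)))))
      (at-toℕ (proj₁ v))))
    (bit-ext _ _ λ t t<k → trans (reflect-bit c (reflect c v) t<k)
      (trans (reflect-bit c v (s≤s (m∸n≤m m t))) (cong (bit (proj₂ v)) (m∸[m∸n]≡n (s≤s⁻¹ t<k)))))
    where
    i  = toℕ (proj₁ v)
    i′ = toℕ (proj₁ (reflect c v))
    i″ = proj₁ (reflect c (reflect c v))

  -- A step-preserving map rotates the layers, and changes the bit at each position
  -- of ℤₙ by a function of that bit alone.
  module StepMap (g : Vertex → Vertex) (g-step : StepPreserving g) where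

    shift : ℕ
    shift = toℕ (proj₁ (g (at 0 , zeros)))

    layer-walk : ∀ u f j → proj₁ (g (walk u f j)) ≡ at (toℕ (proj₁ (g (walk u f 0))) + j)
    layer-walk u f zero    = sym (trans (cong at (+-identityʳ _)) (at-toℕ _))
    layer-walk u f (suc j) = trans (sym (Step⇒next (g-step (walk-step u f j))))
      (trans (cong next (layer-walk u f j))
        (trans (next-at (L + j)) (cong at (sym (+-suc L j)))))
      where L = toℕ (proj₁ (g (walk u f 0)))

    bit-walk : ∀ u f j {t s} → t + s < k →
      bit (proj₂ (g (walk u f j))) (t + s) ≡ bit (proj₂ (g (walk u f (s + j)))) t
    bit-walk u f j {t} {zero}  _ = cong (bit (proj₂ (g (walk u f j)))) (+-identityʳ t)
    bit-walk u f j {t} {suc s} l = trans (cong (bit (proj₂ (g (walk u f j)))) (+-suc t s))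
      (trans (sym (Step⇒bit (g-step (walk-step u f j)) (s≤s⁻¹ l′)))
        (trans (bit-walk u f (suc j) {t} {s} (<-trans (n<1+n (t + s)) l′))
          (cong (λ i → bit (proj₂ (g (walk u f i))) t) (+-suc s j))))
      where
      l′ : suc (t + s) < k
      l′ = subst (_< k) (+-suc t s) l

    -- After `k` steps the walk from `(at u , x)` has merged with the walk of zero vertices.
    -- Comparing the image layers there and cancelling `k` shows that every layer is rotated by the
    -- same amount.
    layer : ∀ u x → proj₁ (g (at u , x)) ≡ at (shift + u)
    layer u x = trans (sym (at-toℕ _)) (at-+-cancelʳ k (begin
      at (toℕ (proj₁ (g (at u , x))) + k)              ≡⟨ cong (λ v → at (toℕ (proj₁ (g v)) + k)) (sym (walk-start u x)) ⟩
      at (toℕ (proj₁ (g (walk u (bit x) 0))) + k)      ≡⟨ layer-walk u (bit x) k ⟨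
      proj₁ (g (walk u (bit x) k))                     ≡⟨ cong (λ v → proj₁ (g v)) (walk-zeros u x ≤-refl) ⟩
      proj₁ (g (walk 0 (λ _ → false) (u + k)))         ≡⟨ layer-walk 0 (λ _ → false) (u + k) ⟩
      at (shift + (u + k))                             ≡⟨ cong at (sym (+-assoc shift u k)) ⟩
      at (shift + u + k)                               ∎))
      where open ≡-Reasoning

    -- The zeros are an arbitrary filling: by `local` the first bit of the image does not depend on
    -- them.
    letter : Fin n → Bool → Bool
    letter p b = bit (proj₂ (g (p , b ∷ zeros))) 0

    private
      -- The first bit of the image is the last bit of the image m steps earlier,
      -- and there z is not yet visible.
      local : ∀ p b (z : Vec Bool m) → bit (proj₂ (g (p , b ∷ z))) 0 ≡ letter p b
      local p b z = trans (earlier z) (trans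
        (cong (λ x → bit (proj₂ (g (at (w + 0) , x))) m) (window-cong k λ t t<k →
          trans (cong (bit (b ∷ z)) (m≤n⇒m∸n≡0 (s≤s⁻¹ t<k)))
            (cong (bit (b ∷ zeros {m})) (sym (m≤n⇒m∸n≡0 (s≤s⁻¹ t<k))))))
        (sym (earlier zeros)))
        where
        -- The layer `m` steps before `p`.
        w = toℕ p + N * m
        word : Vec Bool m → ℕ → Bool
        -- Truncated subtraction repeats `b` in front: the first `k` letters are all `b`, whatever
        -- `z` is.
        word z t = bit (b ∷ z) (t ∸ m)
        regroup : ∀ N p m → p + N * m + m ≡ p + m * suc N
        regroup = solve-∀
        end : ∀ z → walk w (word z) m ≡ (p , b ∷ z)
        end z = cong₂ _,_ (trans (cong at (regroup N (toℕ p) m)) (trans (at-+*n (toℕ p) m) (at-toℕ p)))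
          (trans (window-cong k λ t _ → cong (bit (b ∷ z)) (m+n∸m≡n m t)) (window-bit (b ∷ z)))
        earlier : ∀ z → bit (proj₂ (g (p , b ∷ z))) 0 ≡ bit (proj₂ (g (walk w (word z) 0))) m
        earlier z = sym (trans (bit-walk w (word z) 0 {0} {m} ≤-refl)
          (cong (λ v → bit (proj₂ (g v)) 0)
            (trans (cong (walk w (word z)) (+-identityʳ m)) (end z))))

    -- Sliding the window by `t` steps brings position `u + t` to the front, where `local` applies.
    bits : ∀ u x {t} → t < k → bit (proj₂ (g (at u , x))) t ≡ letter (at (u + t)) (bit x t)
    bits u x {t} t<k = trans (cong (λ v → bit (proj₂ (g v)) t) (sym (walk-start u x)))
      (trans (bit-walk u (bit x) 0 {0} {t} t<k)
        (trans (cong (λ j → bit (proj₂ (g (walk u (bit x) j))) 0) (+-identityʳ t))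
          (trans (local (at (u + t)) (bit x (t + 0)) _)
            (cong (λ j → letter (at (u + t)) (bit x j)) (+-identityʳ t)))))

    -- The images of `a ∷ zeros` and `b ∷ zeros` agree in the layer and in all later bits, so equal
    -- letters would make them the same vertex.
    letter-injective : Injective _≡_ _≡_ g → ∀ p {a b} → letter p a ≡ letter p b → a ≡ b
    letter-injective inj p {a} {b} e = cong (λ v → bit (proj₂ v) 0) (inj
      (subst (λ p → g (p , a ∷ zeros) ≡ g (p , b ∷ zeros)) (at-toℕ p)
        (cong₂ _,_ (trans (layer u (a ∷ zeros)) (sym (layer u (b ∷ zeros)))) (bit-ext _ _ agree))))
      where
      u = toℕ p
      p′ : at (u + 0) ≡ p
      p′ = trans (cong at (+-identityʳ u)) (at-toℕ p)
      agree : ∀ t → t < k → bit (proj₂ (g (at u , a ∷ zeros))) t ≡ bit (proj₂ (g (at u , b ∷ zeros))) t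
      agree zero    t<k = trans (bits u (a ∷ zeros) t<k)
        (trans (subst (λ p → letter p a ≡ letter p b) (sym p′) e) (sym (bits u (b ∷ zeros) t<k)))
      agree (suc t) t<k = trans (bits u (a ∷ zeros) t<k) (sym (bits u (b ∷ zeros) t<k))

automorphism-injective : ∀ {G} (σ : Automorphism G) → Injective _≡_ _≡_ (Inverse.to (perm σ))
automorphism-injective σ e = trans (sym (Inverse.inverseʳ (perm σ) refl)) (Inverse.inverseʳ (perm σ) e)

-- Rigidity of the constructed class.

module Rigid (N m M r′ : ℕ) (n+r≡Mk : suc N + suc r′ ≡ M * suc m) (r<k : suc r′ < suc m)
  (2≤M : 2 ≤ M) (4<n : 4 < suc N) where

  open Symmetries N m public

  r : ℕ
  r = suc r′

  1≤m : 1 ≤ m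
  1≤m = ≤-trans (s≤s z≤n) (s≤s⁻¹ r<k)

  -- The windows of base 0, …, base (M - 1) start k apart and wrap around, the last one
  -- meeting the first in r positions.  For r = 1 the two overlapping
  -- windows could be exchanged, which the additional vertex (at 0 , zeros) prevents.
  base : ℕ → Vertex
  base zero    = at 0 , true ∷ zeros
  base (suc j) = at (suc j * k) , zeros

  InClass : Vertex → Set
  InClass v = (∃ λ j → j < M × v ≡ base j) ⊎ (r′ ≡ 0 × v ≡ (at 0 , zeros))

  base-layer : ∀ j → proj₁ (base j) ≡ at (j * k)
  base-layer zero    = refl
  base-layer (suc j) = refl

  class-layer : ∀ {v} → InClass v → ∃ λ j → j < M × proj₁ v ≡ at (j * k)
  class-layer (inj₁ (j , j<M , refl)) = j , j<M , base-layer j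
  class-layer (inj₂ (_ , refl))       = 0 , ≤-trans (s≤s z≤n) 2≤M , refl

  class-bits : ∀ {v} → InClass v → ∀ t → bit (proj₂ v) (suc t) ≡ false
  class-bits (inj₁ (zero  , _ , refl)) t = bit-zeros {m} t
  class-bits (inj₁ (suc j , _ , refl)) t = bit-zeros {k} (suc t)
  class-bits (inj₂ (_ , refl))         t = bit-zeros {k} (suc t)

  class-zeros : ∀ {v} → InClass v → proj₁ v ≢ at 0 → proj₂ v ≡ zeros
  class-zeros (inj₁ (zero  , _ , refl)) ≢0 = ⊥-elim (≢0 refl)
  class-zeros (inj₁ (suc j , _ , refl)) ≢0 = refl
  class-zeros (inj₂ (_ , refl))         ≢0 = refl

  -- Removing one `k` from `M * k`, which is `n + r`, leaves less than `n` because `r < k`. Hence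
  -- the starting layers are distinct and do not wrap around.
  j*k<n : ∀ {j} → j < M → j * k < n
  j*k<n {j} j<M = +-cancelʳ-< k (j * k) n (begin-strict
    j * k + k  ≡⟨ +-comm (j * k) k ⟩
    suc j * k  ≤⟨ *-monoˡ-≤ k j<M ⟩
    M * k      ≡⟨ n+r≡Mk ⟨
    n + r      <⟨ +-monoʳ-< n r<k ⟩
    n + k      ∎)
    where open ≤-Reasoning

  k<n : k < n
  k<n = subst (_< n) (+-identityʳ k) (j*k<n 2≤M)

  multiple≢0 : ∀ {j} → suc j < M → at (suc j * k) ≢ at 0
  multiple≢0 j<M e with at-+-absorb 0 (j*k<n j<M) e
  ... | ()

  at-Mk : at (M * k) ≡ at r
  at-Mk = trans (cong at (trans (sym n+r≡Mk) (+-comm n r))) (at-+n r)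

  r≢0 : at r ≢ at 0
  r≢0 e with at-+-absorb 0 (<-trans r<k k<n) e
  ... | ()

  -- `r` lies strictly between the first two starting layers, 0 and `k`.
  r≢multiple : ∀ {j} → j < M → at r ≢ at (j * k)
  r≢multiple {zero}  _   = r≢0
  r≢multiple {suc j} j<M e = <⇒≱ r<k (≤-trans (m≤m+n k (j * k))
    (≤-reflexive (sym (at-inj (<-trans r<k k<n) (j*k<n j<M) e))))

  -- Direction-preserving automorphisms that preserve the class.

  module Forward (f : Vertex → Vertex) (f-inj : Injective _≡_ _≡_ f) (f-step : StepPreserving f)
    (f-class : ∀ {v} → InClass v → InClass (f v)) where

    open StepMap f f-step

    base-class : ∀ {j} → j < M → InClass (base j)
    base-class {j} j<M = inj₁ (j , j<M , refl)

    layer-base : ∀ j → proj₁ (f (base j)) ≡ at (shift + j * k)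
    layer-base zero    = layer 0 (true ∷ zeros)
    layer-base (suc j) = layer (suc j * k) zeros

    -- A nonzero shift, by jk say, would send layer (M - j)k to Mk ≡ r.
    shift≡0 : at shift ≡ at 0
    shift≡0 with class-layer (f-class (base-class (≤-trans (s≤s z≤n) 2≤M)))
    ... | zero  , _   , e = trans (cong at (sym (+-identityʳ shift))) (trans (sym (layer-base 0)) e)
    ... | suc j , j<M , e with m≤n⇒∃[o]m+o≡n (<⇒≤ j<M)
    ...   | d , sj+d≡M with class-layer (f-class (base-class {d} (subst (d <_) sj+d≡M (s≤s (m≤n+m d j)))))
    ...     | i , i<M , e′ = ⊥-elim (r≢multiple i<M (begin
      at r                    ≡⟨ at-Mk ⟨
      at (M * k)              ≡⟨ cong (λ M → at (M * k)) sj+d≡M ⟨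
      at ((suc j + d) * k)    ≡⟨ cong at (*-distribʳ-+ k (suc j) d) ⟩
      at (suc j * k + d * k)  ≡⟨ at-+-cong (trans (sym e) (trans (layer-base 0) (cong at (+-identityʳ shift)))) refl ⟩
      at (shift + d * k)      ≡⟨ layer-base d ⟨
      proj₁ (f (base d))      ≡⟨ e′ ⟩
      at (i * k)              ∎))
      where open ≡-Reasoning

    layer-fixed : ∀ u x → proj₁ (f (at u , x)) ≡ at u
    layer-fixed u x = trans (layer u x) (at-+-cong {shift} {0} shift≡0 refl)

    -- Such a position is read by some `base (suc j)`, whose word is zero. Its image stays in the
    -- same layer, which is not 0, and the class has only the zero word there.
    letter-false-block : ∀ {u} → k ≤ u → u < M * k → letter (at u) false ≡ false
    letter-false-block {u} k≤u u<Mk with u / k in q≡ | m≡m%n+[m/n]*n u k | m%n<n u k | m<n*o⇒m/o<n {u} {M} {k} u<Mk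
    ... | zero  | u≡ | t<k | _   = ⊥-elim (<⇒≱ t<k (subst (k ≤_) (trans u≡ (+-identityʳ (u % k))) k≤u))
    ... | suc j | u≡ | t<k | j<M = begin
      letter (at u) false
        ≡⟨ cong₂ (λ u b → letter (at u) b) (trans u≡ (+-comm t (suc j * k))) (sym (bit-zeros {k} t)) ⟩
      letter (at (suc j * k + t)) (bit (zeros {k}) t)
        ≡⟨ bits (suc j * k) zeros t<k ⟨
      bit (proj₂ (f (base (suc j)))) t
        ≡⟨ cong (λ x → bit x t) (class-zeros (f-class (base-class j<M))
             (multiple≢0 j<M ∘ trans (sym (layer-fixed (suc j * k) zeros)))) ⟩
      bit (zeros {k}) t
        ≡⟨ bit-zeros {k} t ⟩
      false ∎
      where
      open ≡-Reasoning
      t = u % k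

    n<Mk : n < M * k
    n<Mk = subst (n <_) n+r≡Mk (m<m+n n z<s)

    letter-false : ∀ p → letter p false ≡ false
    letter-false p = subst (λ p → letter p false ≡ false) (at-toℕ p) (go (toℕ p) (toℕ<n p))
      where
      go : ∀ u → u < n → letter (at u) false ≡ false
      -- `base 0` writes the 1 at position 0, but the same position is also `n`, where the last
      -- window writes a zero.
      go zero    _   = subst (λ p → letter p false ≡ false) (at-+n 0) (letter-false-block (<⇒≤ k<n) n<Mk)
      go (suc u) u<n with suc u <? k
      ... | no u≮k  = letter-false-block (≮⇒≥ u≮k) (<-trans u<n n<Mk)
      ... | yes u<k = trans (cong (letter (at (suc u))) (sym (bit-zeros {m} u)))
        (trans (sym (bits 0 (true ∷ zeros) u<k)) (class-bits (f-class (base-class (≤-trans (s≤s z≤n) 2≤M))) u))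

    letter-id : ∀ p b → letter p b ≡ b
    letter-id p false = letter-false p
    letter-id p true  with letter p true in e
    ... | true  = refl
    ... | false with letter-injective f-inj p (trans e (sym (letter-false p)))
    ...   | ()

    fixed : ∀ v → f v ≡ v
    fixed v = trans (cong f (lift v)) (trans (cong₂ _,_ (layer-fixed u x)
      (bit-ext _ _ λ t t<k → trans (bits u x t<k) (letter-id (at (u + t)) (bit x t)))) (sym (lift v)))
      where
      u = toℕ (proj₁ v)
      x = proj₂ v

  -- Direction-reversing automorphisms that preserve the class.

  module Backward (f : Vertex → Vertex) (f-inj : Injective _≡_ _≡_ f) (f-step : StepReversing f)
    (f-class : ∀ {v} → InClass v → InClass (f v)) where

    -- Composing with a reflection restores the directions, so that `StepMap` applies.
    g : Vertex → Vertex
    g = reflect 0 ∘ f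

    open StepMap g (λ s → reflect-reversing 0 (f-step s))

    g-inj : Injective _≡_ _≡_ g
    g-inj {u} {v} e = f-inj (trans (sym (reflect-involutive 0 (f u)))
      (trans (cong (reflect 0) e) (reflect-involutive 0 (f v))))

    base-class : ∀ {j} → j < M → InClass (base j)
    base-class {j} j<M = inj₁ (j , j<M , refl)

    -- `f` acts on layers as a reflection: a layer and its image have the constant sum -`shift`.
    f-layer : ∀ u x {w} → proj₁ (f (at u , x)) ≡ at w → at (shift + (u + w)) ≡ at 0
    f-layer u x {w} e = begin
      at (shift + (u + w))      ≡⟨ cong at (trans (sym (+-assoc shift u w)) (+-comm (shift + u) w)) ⟩
      at (w + (shift + u))      ≡⟨ at-+-cong {w} {toℕ (proj₁ (f v))} (trans (sym e) (sym (at-toℕ _)))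
                                     (trans (sym (layer u x)) (sym (at-toℕ _))) ⟩
      at (toℕ (proj₁ (f v)) + toℕ (proj₁ (g v))) ≡⟨ reflect-layer 0 (f v) ⟩
      at 0                      ∎
      where
      open ≡-Reasoning
      v = at u , x

    layer-sum : ∀ u x {w} → proj₁ (f (at u , x)) ≡ at w →
                ∀ u′ x′ {w′} → proj₁ (f (at u′ , x′)) ≡ at w′ → at (u + w) ≡ at (u′ + w′)
    layer-sum u x e u′ x′ e′ = at-+-cancelˡ shift (trans (f-layer u x e) (sym (f-layer u′ x′ e′)))

    f-bits : ∀ u x {t} → t < k → bit (proj₂ (f (at u , x))) t ≡ letter (at (u + (m ∸ t))) (bit x (m ∸ t))
    f-bits u x {t} t<k = trans (cong (λ v → bit (proj₂ v) t) (sym (reflect-involutive 0 (f (at u , x)))))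
      (trans (reflect-bit 0 (g (at u , x)) t<k) (bits u x (s≤s (m∸n≤m m t))))

    -- Let `base 0` go to layer `j * k`. If `suc j < M`, then `base (suc j)` goes to some layer
    -- `i * k`, and equal sums force `suc i * k` to be 0 in ℤₙ; but it is a nonzero starting layer,
    -- or `M * k`, which is `r`. So `base 0` goes to the last window, and `split` treats `r` = 1 and
    -- `r` ≥ 2.
    impossible : ⊥
    impossible with class-layer (f-class (base-class (≤-trans (s≤s z≤n) 2≤M)))
    ... | j , j<M , e with m≤n⇒m<n∨m≡n j<M
    ...   | inj₁ sj<M with class-layer (f-class (base-class sj<M))
    ...     | i , i<M , e′ with m≤n⇒m<n∨m≡n i<M | at-+-cancelˡ (j * k) {suc i * k} {0} (trans
                (trans (cong at (regroup (j * k) k (i * k))) (layer-sum (suc j * k) zeros e′ 0 (true ∷ zeros) e))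
                (cong at (sym (+-identityʳ (j * k)))))
      where
      regroup : ∀ a k b → a + (k + b) ≡ (k + a) + b
      regroup = solve-∀
    ...       | inj₁ si<M | z = multiple≢0 si<M z
    ...       | inj₂ refl | z = r≢0 (trans (sym at-Mk) z)
    impossible | zero  , j<M , e | inj₂ refl = case 2≤M
      where
      case : 2 ≤ 1 → ⊥
      case (s≤s ())
    impossible | suc j , j<M , e | inj₂ refl = split r′ refl
      where
      0<M : 0 < M
      0<M = ≤-trans (s≤s z≤n) 2≤M
      last = suc j
      f-base₀ : f (base 0) ≡ base last
      f-base₀ = cong₂ _,_ e (class-zeros (f-class (base-class 0<M)) (multiple≢0 j<M ∘ trans (sym e)))
      split : ∀ s → s ≡ r′ → ⊥
      -- For `r` = 1 the additional vertex shares the layer of `base 0`, so both are sent to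
      -- `base last`, against injectivity.
      split zero 0≡r′ with class-layer (f-class (inj₂ (sym 0≡r′ , refl)))
      ... | i , i<M , e′ = case (cong (λ v → bit (proj₂ v) 0) (f-inj (trans f-base₀ (sym f-zeros))))
        where
        case : true ≢ false
        case ()
        e″ : proj₁ (f (at 0 , zeros)) ≡ at (last * k)
        e″ = trans e′ (layer-sum 0 zeros e′ 0 (true ∷ zeros) e)
        f-zeros : f (at 0 , zeros) ≡ base last
        f-zeros = cong₂ _,_ e″ (class-zeros (f-class (inj₂ (sym 0≡r′ , refl)))
          (multiple≢0 j<M ∘ trans (sym e″)))
      -- For `r` ≥ 2 the letter map at position 0 would send both bits to `false`: the 1 of `base 0`
      -- becomes the last bit of a zero word, and the zero of the last window becomes a bit of place
      -- at least 1 in a class vertex.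
      split (suc s) s≡r′ = case (letter-injective g-inj (at 0) (trans true↦ (sym false↦)))
        where
        case : true ≢ false
        case ()
        true↦ : letter (at 0) true ≡ false
        true↦ = trans (cong (λ t → letter (at t) (bit (true ∷ zeros {m}) t)) (sym (n∸n≡0 m)))
          (trans (sym (f-bits 0 (true ∷ zeros) ≤-refl))
            (trans (cong (λ v → bit (proj₂ v) m) f-base₀) (bit-zeros {k} m)))
        -- Place k - r, where the last window reads position `n`, which is 0 in ℤₙ.
        t = m ∸ r′
        r′≤m : r′ ≤ m
        r′≤m = ≤-trans (n≤1+n r′) (s≤s⁻¹ r<k)
        position : last * k + t ≡ n
        position = +-cancelʳ-≡ r _ _ (begin
          last * k + t + r          ≡⟨ regroup (last * k) t r′ ⟩
          suc (t + r′) + last * k   ≡⟨ cong (λ m′ → suc m′ + last * k) (m∸n+n≡m r′≤m) ⟩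
          k + last * k              ≡⟨ n+r≡Mk ⟨
          n + r                  ∎)
          where
          open ≡-Reasoning
          regroup : ∀ a t s → a + t + suc s ≡ suc (t + s) + a
          regroup = solve-∀
        false↦ : letter (at 0) false ≡ false
        false↦ = begin
          letter (at 0) false                      ≡⟨ cong₂ letter (trans (sym (at-+n 0)) (cong at (sym position))) (sym (bit-zeros {k} t)) ⟩
          letter (at (last * k + t)) (bit (zeros {k}) t) ≡⟨ f-bits (last * k) zeros (s≤s r′≤m) ⟨
          bit (proj₂ (f (base last))) r′              ≡⟨ cong (bit (proj₂ (f (base last)))) (sym s≡r′) ⟩
          bit (proj₂ (f (base last))) (suc s)         ≡⟨ class-bits (f-class (base-class {last} j<M)) s ⟩
          false ∎
          where open ≡-Reasoning

  rigid : (σ : Automorphism (PX n k)) → (∀ {v} → InClass v → InClass (Inverse.to (perm σ) v)) →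
    ∀ v → Inverse.to (perm σ) v ≡ v
  rigid σ σ-class with Direction.direction 1≤m 4<n σ
  ... | inj₁ p = Forward.fixed _ (automorphism-injective σ) p σ-class
  ... | inj₂ p = ⊥-elim (Backward.impossible _ (automorphism-injective σ) p σ-class)

-- Colourings given by a list of vertices.

module ImageColoring (G : Graph) (_≟_ : DecidableEquality (V G))
  {s : ℕ} (vertex : Fin s → V G) where

  image? : ∀ v → Dec (∃ λ j → vertex j ≡ v)
  image? v = any? (λ j → vertex j ≟ v)

  coloring : Coloring G
  coloring v = does (image? v)

  colored⇒image : ∀ {v} → coloring v ≡ true → ∃ λ j → vertex j ≡ v
  colored⇒image {v} e with image? v
  colored⇒image refl | yes p = p

  image⇒colored : ∀ {v} → (∃ λ j → vertex j ≡ v) → coloring v ≡ true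
  image⇒colored {v} p = dec-true (image? v) p

  classSize : Injective _≡_ _≡_ vertex → ClassSize G coloring true s
  classSize inj = mk↔ₛ′ (λ j → vertex j , image⇒colored (j , refl))
    (λ (v , e) → proj₁ (colored⇒image e))
    (λ (v , e) → member-≡ (proj₂ (colored⇒image e)))
    (λ j → inj (proj₂ (colored⇒image (image⇒colored (j , refl)))))
    where
    member-≡ : ∀ {v w} {p : coloring v ≡ true} {q : coloring w ≡ true} → v ≡ w → (v , p) ≡ (w , q)
    member-≡ {v} {p = p} {q} refl = cong (v ,_) (Decidable⇒UIP.≡-irrelevant _≟ᵇ_ p q)

  distinguishing : (InClass : V G → Set) →
    (∀ {v} → InClass v → ∃ λ j → vertex j ≡ v) → (∀ j → InClass (vertex j)) →
    (∀ (σ : Automorphism G) → (∀ {v} → InClass v → InClass (Inverse.to (perm σ) v)) →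
      ∀ v → Inverse.to (perm σ) v ≡ v) →
    Distinguishing G coloring
  distinguishing InClass to-image from-image rigid σ fixes = rigid σ λ {v} v∈ →
    let j , e = colored⇒image (trans (fixes v) (image⇒colored (to-image v∈)))
    in subst InClass e (from-image j)

-- Distinguishing colourings of the claimed size.

module Existence (N m M r′ : ℕ) (n+r≡Mk : suc N + suc r′ ≡ M * suc m) (r<k : suc r′ < suc m)
  (2≤M : 2 ≤ M) (4<n : 4 < suc N) where

  open Rigid N m M r′ n+r≡Mk r<k 2≤M 4<n

  _≟ᵛ_ : DecidableEquality Vertex
  _≟ᵛ_ = ≡-decˣ _≟ᶠ_ (≡-decᵛ _≟ᵇ_)

  HasColoring : ℕ → Set
  HasColoring s = Σ (Coloring (PX n k)) λ c → Distinguishing (PX n k) c × Σ Bool λ b → ClassSize (PX n k) c b s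

  base-injective : ∀ {i j} → i < M → j < M → base i ≡ base j → i ≡ j
  base-injective {i} {j} i<M j<M e = *-cancelʳ-≡ i j k (at-inj (j*k<n i<M) (j*k<n j<M)
    (trans (sym (base-layer i)) (trans (cong proj₁ e) (base-layer j))))

  zeros≢base : ∀ {j} → j < M → (at 0 , zeros) ≢ base j
  zeros≢base {zero}  _   ()
  zeros≢base {suc j} j<M e = multiple≢0 j<M (sym (cong proj₁ e))

  base-image : ∀ {j} → j < M → Σ (Fin M) λ i → base (toℕ i) ≡ base j
  base-image j<M = fromℕ< j<M , cong base (toℕ-fromℕ< j<M)

  exists-M : r′ ≢ 0 → HasColoring M
  exists-M r′≢0 = coloring , distinguishing InClass image inClass rigid , true ,
    classSize λ {i} {j} e → toℕ-injective (base-injective (toℕ<n i) (toℕ<n j) e)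
    where
    open ImageColoring (PX n k) _≟ᵛ_ (λ (j : Fin M) → base (toℕ j))
    image : ∀ {v} → InClass v → ∃ λ (j : Fin M) → base (toℕ j) ≡ v
    image (inj₁ (j , j<M , refl)) = base-image j<M
    image (inj₂ (r′≡0 , _))       = ⊥-elim (r′≢0 r′≡0)
    inClass : ∀ (j : Fin M) → InClass (base (toℕ j))
    inClass j = inj₁ (toℕ j , toℕ<n j , refl)

  exists-1+M : r′ ≡ 0 → HasColoring (suc M)
  exists-1+M r′≡0 = coloring , distinguishing InClass image inClass rigid , true , classSize inj
    where
    vertex : Fin (suc M) → Vertex
    vertex zero    = at 0 , zeros
    vertex (suc j) = base (toℕ j)
    open ImageColoring (PX n k) _≟ᵛ_ vertex
    image : ∀ {v} → InClass v → ∃ λ j → vertex j ≡ v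
    image (inj₁ (j , j<M , refl)) = (let i , e = base-image j<M in suc i , e)
    image (inj₂ (_ , refl))       = zero , refl
    inClass : ∀ j → InClass (vertex j)
    inClass zero    = inj₂ (r′≡0 , refl)
    inClass (suc j) = inj₁ (toℕ j , toℕ<n j , refl)
    inj : Injective _≡_ _≡_ vertex
    inj {zero}  {zero}  _ = refl
    inj {zero}  {suc j} e = ⊥-elim (zeros≢base (toℕ<n j) e)
    inj {suc i} {zero}  e = ⊥-elim (zeros≢base (toℕ<n i) (sym e))
    inj {suc i} {suc j} e = cong suc (toℕ-injective (base-injective (toℕ<n i) (toℕ<n j) e))

-- Counting in finite sets.

injective⇒surjective : ∀ {n} {f : Fin n → Fin n} → Injective _≡_ _≡_ f → StrictlySurjective _≡_ f
injective⇒surjective {suc n} {f} inj y with any? (λ x → f x ≟ᶠ y)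
... | yes p = p
... | no ¬p = ⊥-elim (<⇒≱ (n<1+n n) (injective⇒≤ {f = λ x → punchOut (avoid x)}
                (λ {x} {z} e → inj (punchOut-injective (avoid x) (avoid z) e))))
  where
  avoid : ∀ x → y ≢ f x
  avoid x e = ¬p (x , sym e)

section-injective : ∀ {A B : Set} {f : A → B} (surj : StrictlySurjective _≡_ f) →
  Injective _≡_ _≡_ (λ y → proj₁ (surj y))
section-injective {f = f} surj {x} {y} e = trans (sym (proj₂ (surj x))) (trans (cong f e) (proj₂ (surj y)))

-- A section of `f` is injective, hence onto; so `x` and `y` are values of the section, and `f`
-- recovers their arguments.
surjective⇒injective : ∀ {n} {f : Fin n → Fin n} → StrictlySurjective _≡_ f → Injective _≡_ _≡_ f
surjective⇒injective {f = f} surj {x} {y} fx≡fy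
  with p , refl ← injective⇒surjective (section-injective surj) x
     | q , refl ← injective⇒surjective (section-injective surj) y =
  cong (λ z → proj₁ (surj z)) (trans (sym (proj₂ (surj p))) (trans fx≡fy (proj₂ (surj q))))

-- Since `y` has the same value as `x`, deleting `x` leaves a surjection between sets of size `n`,
-- which is injective. Every collision therefore involves `x`.
collision-unique : ∀ {n} {f : Fin (suc n) → Fin n} → StrictlySurjective _≡_ f →
  ∀ {x y x′ y′} → x ≢ y → f x ≡ f y → x′ ≢ y′ → f x′ ≡ f y′ → x′ ≡ x ⊎ y′ ≡ x
collision-unique {n} {f} surj {x} {y} {x′} {y′} x≢y e x′≢y′ e′ with x ≟ᶠ x′ | x ≟ᶠ y′
... | yes p | _     = inj₁ (sym p)
... | no _  | yes p = inj₂ (sym p)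
... | no p  | no q  = ⊥-elim (x′≢y′ (punchOut-injective p q (surjective⇒injective onto
  (trans (cong f (punchIn-punchOut p)) (trans e′ (cong f (sym (punchIn-punchOut q))))))))
  where
  onto : StrictlySurjective _≡_ (f ∘ punchIn x)
  onto z with surj z
  ... | w , fw≡z with x ≟ᶠ w
  ...   | yes refl = punchOut x≢y , trans (cong f (punchIn-punchOut x≢y)) (trans (sym e) fw≡z)
  ...   | no x≢w   = punchOut x≢w , trans (cong f (punchIn-punchOut x≢w)) fw≡z

module Grid {M K n : ℕ} (G : Fin M × Fin K → Fin n) (surj : StrictlySurjective _≡_ G) where

  unquot : Fin (M * K) → Fin n
  unquot = G ∘ remQuot {M} K

  unquot-surj : StrictlySurjective _≡_ unquot
  unquot-surj z = let (a , t) , e = surj z in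
    combine a t , trans (cong G (remQuot-combine a t)) e

  size : n ≤ M * K
  size = injective⇒≤ (section-injective unquot-surj)

  remQuot-injective : ∀ {x y} → remQuot {M} K x ≡ remQuot K y → x ≡ y
  remQuot-injective {x} {y} e = trans (sym (combine-remQuot {M} K x))
    (trans (cong (uncurry combine) e) (combine-remQuot {M} K y))

  collision : n < M * K → ∃₂ λ x y → x ≢ y × G x ≡ G y
  collision lt = let i , j , i<j , e = pigeonhole lt unquot in
    remQuot {M} K i , remQuot {M} K j , <⇒≢ᶠ i<j ∘ remQuot-injective , e

  unique : M * K ≡ suc n → ∀ {x y x′ y′} → x ≢ y → G x ≡ G y → x′ ≢ y′ → G x′ ≡ G y′ →
    x′ ≡ x ⊎ y′ ≡ x
  unique MK {x} {y} {x′} {y′} x≢y e x′≢y′ e′ =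
    map (back x x′) (back x y′) (go MK unquot unquot-surj (x≢y ∘ uncombine x y) (under x y e)
      (x′≢y′ ∘ uncombine x′ y′) (under x′ y′ e′))
    where
    pack : Fin M × Fin K → Fin (M * K)
    pack = uncurry combine
    uncombine : ∀ x y → pack x ≡ pack y → x ≡ y
    uncombine (a , t) (b , s) e = trans (sym (remQuot-combine a t))
      (trans (cong (remQuot K) e) (remQuot-combine b s))
    under : ∀ x y → G x ≡ G y → unquot (pack x) ≡ unquot (pack y)
    under (a , t) (b , s) e = trans (cong G (remQuot-combine a t)) (trans e (cong G (sym (remQuot-combine b s))))
    back : ∀ x y → pack y ≡ pack x → y ≡ x
    back x y = uncombine y x
    -- The length is made a variable so that matching on the equation turns it into the `suc n` of
    -- `collision-unique`.
    go : ∀ {L} → L ≡ suc n → (f : Fin L → Fin n) → StrictlySurjective _≡_ f →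
      ∀ {x y x′ y′} → x ≢ y → f x ≡ f y → x′ ≢ y′ → f x′ ≡ f y′ → x′ ≡ x ⊎ y′ ≡ x
    go refl f s = collision-unique s

-- Toggles, and the covering property of colour classes.

module Flips (N m : ℕ) where

  open Symmetries N m public

  -- Whether a bit is toggled depends on its position `toℕ i + t` in ℤₙ, not on its place in the
  -- word; hence the overlapping words of a step stay consistent.
  flip : (Fin n → Bool) → Vertex → Vertex
  flip T (i , x) = i , window k (λ t → bit x t xor T (at (toℕ i + t)))

  flip-bit : ∀ T (v : Vertex) {t} → t < k →
    bit (proj₂ (flip T v)) t ≡ bit (proj₂ v) t xor T (at (toℕ (proj₁ v) + t))
  flip-bit T (i , x) t<k = bit-window k (λ t → bit x t xor T (at (toℕ i + t))) t<k

  flip-step : ∀ T → StepPreserving (flip T)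
  flip-step T {u} {v} s = mkStep (Step⇒next s) λ {t} t<m →
    trans (flip-bit T v (m<n⇒m<1+n t<m)) (trans
      (cong₂ (λ b p → b xor T p) (Step⇒bit s t<m)
        (trans (cong (λ j → at (toℕ j + t)) (sym (Step⇒next s)))
          (trans (at-toℕ-at-+ (suc (toℕ (proj₁ u))) t) (cong at (sym (+-suc (toℕ (proj₁ u)) t))))))
      (sym (flip-bit T u (s<s t<m))))

  flip-involutive : ∀ T (v : Vertex) → flip T (flip T v) ≡ v
  flip-involutive T v = cong (proj₁ v ,_) (bit-ext _ _ λ t t<k →
    let b = bit (proj₂ v) t
        c = T (at (toℕ (proj₁ v) + t)) in
    trans (flip-bit T (flip T v) t<k) (trans (cong (_xor c) (flip-bit T v t<k))
      (trans (xor-assoc b c c) (trans (cong (b xor_) (xor-same c)) (xor-identityʳ b)))))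

  preserving⇒adj : ∀ {g} → StepPreserving g → ∀ {u v} → Adj′ u v → Adj′ (g u) (g v)
  preserving⇒adj s = [ inj₁ ∘ s , inj₂ ∘ s ]′

  reversing⇒adj : ∀ {g} → StepReversing g → ∀ {u v} → Adj′ u v → Adj′ (g u) (g v)
  reversing⇒adj s = [ inj₂ ∘ s , inj₁ ∘ s ]′

  automorphism : (f g : Vertex → Vertex) → (∀ v → f (g v) ≡ v) → (∀ v → g (f v) ≡ v) →
    (∀ {u v} → Adj′ u v → Adj′ (f u) (f v)) → (∀ {u v} → Adj′ u v → Adj′ (g u) (g v)) →
    Automorphism (PX n k)
  automorphism f g fg gf f-adj g-adj = record
    { perm     = mk↔ₛ′ f g fg gf
    ; preserve = λ u v → f-adj , λ a → subst₂ Adj′ (gf u) (gf v) (g-adj a)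
    }

  flipAut : (Fin n → Bool) → Automorphism (PX n k)
  flipAut T = automorphism (flip T) (flip T) (flip-involutive T) (flip-involutive T) adj adj
    where
    adj : ∀ {u v} → Adj′ u v → Adj′ (flip T u) (flip T v)
    adj = preserving⇒adj (flip-step T)

  reflectFlipAut : ℕ → (Fin n → Bool) → Automorphism (PX n k)
  reflectFlipAut c T = automorphism (reflect c ∘ flip T) (flip T ∘ reflect c)
    (λ v → trans (cong (reflect c) (flip-involutive T (reflect c v))) (reflect-involutive c v))
    (λ v → trans (cong (flip T) (reflect-involutive c (flip T v))) (flip-involutive T v))
    (reversing⇒adj (λ s → reflect-reversing c (flip-step T s)))
    (reversing⇒adj (λ s → flip-step T (reflect-reversing c s)))

  -- With only two colours, invariance of one class in both directions settles the other class.
  class-preserved⇒color-preserved : ∀ (c : Coloring (PX n k)) b (f : Vertex → Vertex) →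
    (∀ {v} → c v ≡ b → c (f v) ≡ b) → (∀ {v} → c (f v) ≡ b → c v ≡ b) → ∀ v → c (f v) ≡ c v
  class-preserved⇒color-preserved c b f to from v with c v ≟ᵇ b
  ... | yes e = trans (to e) (sym e)
  ... | no ≢b = trans (¬-not (≢b ∘ from)) (sym (¬-not ≢b))

  module ColorClass (c : Coloring (PX n k)) (dist : Distinguishing (PX n k) c)
    (b : Bool) {s : ℕ} (size : ClassSize (PX n k) c b s) where

    vertex : Fin s → Vertex
    vertex a = proj₁ (Inverse.to size a)

    vertex-color : ∀ a → c (vertex a) ≡ b
    vertex-color a = proj₂ (Inverse.to size a)

    vertex-onto : ∀ {v} → c v ≡ b → ∃ λ a → vertex a ≡ v
    vertex-onto {v} e = Inverse.from size (v , e) , cong proj₁ (Inverse.inverseˡ size refl)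

    start : Fin s → ℕ
    start a = toℕ (proj₁ (vertex a))

    cover : Fin s × Fin k → Fin n
    cover (a , t) = at (start a + toℕ t)

    -- The flip of an uncovered position would fix every vertex of the class.
    cover-onto : StrictlySurjective _≡_ cover
    cover-onto p with any? (λ a → any? (λ t → cover (a , t) ≟ᶠ p))
    ... | yes (a , t , e) = (a , t) , e
    ... | no uncovered = ⊥-elim (true≢false (begin
      true                                     ≡⟨ dec-true (p ≟ᶠ _) (sym p′) ⟨
      T (at (toℕ p + 0))                       ≡⟨ flip-bit T (p , zeros) z<s ⟨
      bit (proj₂ (flip T (p , zeros))) 0       ≡⟨ cong (λ v → bit (proj₂ v) 0) (dist (flipAut T)
                                                    (class-preserved⇒color-preserved c b (flip T) stays returns) (p , zeros)) ⟩
      false                                    ∎))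
      where
      open ≡-Reasoning
      true≢false : true ≢ false
      true≢false ()
      T : Fin n → Bool
      T q = does (p ≟ᶠ q)
      p′ : at (toℕ p + 0) ≡ p
      p′ = trans (cong at (+-identityʳ (toℕ p))) (at-toℕ p)
      vertex-fixed : ∀ a → flip T (vertex a) ≡ vertex a
      vertex-fixed a = cong (proj₁ (vertex a) ,_) (bit-ext _ _ λ t t<k →
        trans (flip-bit T (vertex a) t<k) (trans
          (cong (bit (proj₂ (vertex a)) t xor_) (dec-false (p ≟ᶠ _) λ e →
            uncovered (a , fromℕ< t<k , trans (cong (λ t → at (start a + t)) (toℕ-fromℕ< t<k)) (sym e))))
          (xor-identityʳ _)))
      fixed : ∀ {v} → c v ≡ b → flip T v ≡ v
      fixed e = let a , va≡v = vertex-onto e in subst (λ v → flip T v ≡ v) va≡v (vertex-fixed a)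
      stays : ∀ {v} → c v ≡ b → c (flip T v) ≡ b
      stays e = trans (cong c (fixed e)) e
      returns : ∀ {v} → c (flip T v) ≡ b → c v ≡ b
      returns {v} e = trans (cong c (trans (sym (flip-involutive T v)) (fixed e))) e

    n≤s*k : n ≤ s * k
    n≤s*k = Grid.size cover cover-onto

-- No class of exactly (n + 1)/k vertices is distinguishing.

module Tight (N m M : ℕ) (1+n≡Mk : suc (suc N) ≡ M * suc m) (1≤m : 1 ≤ m) (2≤M : 2 ≤ M) (4<n : 4 < suc N)
  (c : Coloring (PX (suc N) (suc m))) (dist : Distinguishing (PX (suc N) (suc m)) c)
  (b : Bool) (size : ClassSize (PX (suc N) (suc m)) c b M) where

  open Flips N m
  open ColorClass c dist b size
  open Rigid N m M 0 (trans (+-comm n 1) 1+n≡Mk) (s≤s 1≤m) 2≤M 4<n using (j*k<n; k<n)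

  record Overlap (a : Fin M) (t : ℕ) (a′ : Fin M) (t′ : ℕ) : Set where
    constructor overlapping
    field
      a≢a′ : a ≢ a′
      t<k  : t < k
      t′<k : t′ < k
      same : at (start a + t) ≡ at (start a′ + t′)

  overlap-sym : ∀ {a t a′ t′} → Overlap a t a′ t′ → Overlap a′ t′ a t
  overlap-sym (overlapping a≢a′ t<k t′<k same) = overlapping (a≢a′ ∘ sym) t′<k t<k (sym same)

  -- The `M` windows have `suc n` places in all and cover `n` positions, so all collisions share a
  -- place.
  overlap-unique : ∀ {a t a′ t′ d s d′ s′} → Overlap a t a′ t′ → Overlap d s d′ s′ →
    (d ≡ a × s ≡ t) ⊎ (d′ ≡ a × s′ ≡ t)
  overlap-unique {a} {t} {a′} {t′} {d} {s} {d′} {s′} (overlapping p t<k t′<k e) (overlapping q s<k s′<k f) =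
    map (unpair s<k t<k) (unpair s′<k t<k)
      (Grid.unique cover cover-onto (sym 1+n≡Mk)
        (p ∘ cong proj₁) (cover-≡ t<k t′<k e) (q ∘ cong proj₁) (cover-≡ s<k s′<k f))
    where
    cover-≡ : ∀ {a t a′ t′} (t<k : t < k) (t′<k : t′ < k) → at (start a + t) ≡ at (start a′ + t′) →
      cover (a , fromℕ< t<k) ≡ cover (a′ , fromℕ< t′<k)
    cover-≡ {a} {t} {a′} t<k t′<k e = trans (cong (λ t → at (start a + t)) (toℕ-fromℕ< t<k))
      (trans e (cong (λ t → at (start a′ + t)) (sym (toℕ-fromℕ< t′<k))))
    unpair : ∀ {d s a t} (s<k : s < k) (t<k : t < k) →
      (d , fromℕ< s<k) ≡ (a , fromℕ< t<k) → d ≡ a × s ≡ t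
    unpair s<k t<k e = cong proj₁ e ,
      trans (sym (toℕ-fromℕ< s<k)) (trans (cong (toℕ ∘ proj₂) e) (toℕ-fromℕ< t<k))

  same-window : ∀ {a t t′} → t < k → t′ < k → at (start a + t) ≡ at (start a + t′) → t ≡ t′
  same-window {a} t<k t′<k e = at-inj (<-trans t<k k<n) (<-trans t′<k k<n) (at-+-cancelˡ (start a) e)

  some-overlap : ∃ λ a → ∃ λ t → ∃ λ a′ → ∃ λ t′ → Overlap a t a′ t′
  some-overlap with Grid.collision cover cover-onto (subst (n <_) 1+n≡Mk (n<1+n n))
  ... | (a , t) , (a′ , t′) , x≢y , e = a , toℕ t , a′ , toℕ t′ , overlapping
    (λ a≡a′ → x≢y (cong₂ _,_ a≡a′ (toℕ-injective (same-window {a} (toℕ<n t) (toℕ<n t′)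
      (trans e (cong (λ a → at (start a + toℕ t′)) (sym a≡a′)))))))
    (toℕ<n t) (toℕ<n t′) e

  -- The preceding places of the two windows would overlap as well, against uniqueness.
  overlap-down : ∀ {a t a′ t′} → ¬ Overlap a (suc t) a′ (suc t′)
  overlap-down {a} {t} {a′} {t′} o@(overlapping p t<k t′<k e) with overlap-unique o
    (overlapping {t = t} {t′ = t′} p (<-trans (n<1+n t) t<k) (<-trans (n<1+n t′) t′<k)
      (at-+-cancelˡ 1 (trans (cong at (sym (+-suc (start a) t))) (trans e (cong at (+-suc (start a′) t′))))))
  ... | inj₁ (_ , t≡) = <⇒≢ (n<1+n t) t≡
  ... | inj₂ (q , _)  = p (sym q)

  overlap-up : ∀ {a t a′ t′} → suc t < k → suc t′ < k → ¬ Overlap a t a′ t′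
  overlap-up {a} {t} {a′} {t′} t<k t′<k o@(overlapping p _ _ e) with overlap-unique o
    (overlapping {t = suc t} {t′ = suc t′} p t<k t′<k
      (trans (cong at (+-suc (start a) t)) (trans (at-+-cong {1} refl e) (cong at (sym (+-suc (start a′) t′))))))
  ... | inj₁ (_ , t≡) = <⇒≢ (n<1+n t) (sym t≡)
  ... | inj₂ (q , _)  = p (sym q)

  -- An overlap that extends neither to the left nor to the right joins the end of one window to the
  -- start of another.
  end-overlap : ∃₂ λ a a′ → Overlap a m a′ 0
  end-overlap with some-overlap
  ... | a , suc t , a′ , suc t′ , o = ⊥-elim (overlap-down o)
  ... | a , zero  , a′ , t′     , o with m≤n⇒m<n∨m≡n (s≤s⁻¹ (Overlap.t′<k o))
  ...   | inj₁ t′<m = ⊥-elim (overlap-up (s≤s 1≤m) (s≤s t′<m) o)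
  ...   | inj₂ refl = a′ , a , overlap-sym o
  end-overlap | a , suc t , a′ , zero , o with m≤n⇒m<n∨m≡n (s≤s⁻¹ (Overlap.t<k o))
  ...   | inj₁ t<m  = ⊥-elim (overlap-up (s≤s t<m) (s≤s 1≤m) o)
  ...   | inj₂ refl = a , a′ , o

  module Progression {last first : Fin M} (ends : Overlap last m first 0) where

    P : ℕ
    P = start first

    overlap-position : ∀ {a t a′ t′} → Overlap a t a′ t′ → at (start a + t) ≡ at P
    overlap-position {a} {t} {a′} {t′} o with overlap-unique ends o
    ... | inj₁ (refl , refl) = trans (Overlap.same ends) (cong at (+-identityʳ P))
    ... | inj₂ (refl , refl) = trans (Overlap.same o) (trans (Overlap.same ends) (cong at (+-identityʳ P)))

    -- By induction: some window covers the position just after window `j`. If it did not start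
    -- there, it would also contain the last position of window `j`, and this overlap would lie away
    -- from `P`, the position of the only one.
    progression : ∀ j → j < M → ∃ λ a → at (start a) ≡ at (P + j * k)
    progression zero    _    = first , cong at (sym (+-identityʳ P))
    progression (suc j) j<M with progression j (<-trans (n<1+n j) j<M) | cover-onto (at (P + suc j * k))
    ... | a , e | (a′ , zero)  , e′ = a′ , trans (cong at (sym (+-identityʳ (start a′)))) e′
    ... | a , e | (a′ , suc t) , e′ = ⊥-elim meet
      where
      t′ = toℕ t
      t′<m : t′ < m
      t′<m = toℕ<n t
      regroup : ∀ P a m → P + (suc m + a) ≡ suc (P + (a + m))
      regroup = solve-∀
      before : at (start a′ + t′) ≡ at (P + (j * k + m))
      before = at-+-cancelˡ 1 (trans (cong at (sym (+-suc (start a′) t′)))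
        (trans e′ (cong at (regroup P (j * k) m))))
      before′ : at (P + (j * k + m)) ≡ at (start a + m)
      before′ = trans (cong at (sym (+-assoc P (j * k) m))) (at-+-cong {P + j * k} {start a} {m} (sym e) refl)
      jk+m<n : j * k + m < n
      jk+m<n = ≤-trans (≤-reflexive (trans (sym (+-suc (j * k) m)) (+-comm (j * k) k))) (<⇒≤ (j*k<n j<M))
      meet : ⊥
      meet with a′ ≟ᶠ a
      ... | yes refl = <⇒≢ t′<m (same-window {a} (m<n⇒m<1+n t′<m) (n<1+n m) (trans before before′))
      ... | no a′≢a  = <⇒≢ 1≤m (sym (m+n≡0⇒n≡0 (j * k) (at-+-absorb P jk+m<n (trans (sym before)
        (overlap-position (overlapping {t = t′} a′≢a (m<n⇒m<1+n t′<m) (n<1+n m) (trans before before′)))))))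

    progression-function : Σ (ℕ → Fin M) λ α → ∀ {j} → j < M → at (start (α j)) ≡ at (P + j * k)
    progression-function = (λ j → proj₁ (total j)) , λ {j} → proj₂ (total j)
      where
      total : ∀ j → Σ (Fin M) λ a → j < M → at (start a) ≡ at (P + j * k)
      total j with j <? M
      ... | yes j<M = let a , e = progression j j<M in a , λ _ → e
      -- An arbitrary value outside the range makes the choice a total function.
      ... | no  j≮M = first , λ j<M → ⊥-elim (j≮M j<M)

  module Arranged (P : ℕ) (α : ℕ → Fin M) (α-start : ∀ {j} → j < M → at (start (α j)) ≡ at (P + j * k)) where

    -- The starts P + jk for j < M are distinct, so these are `M` different windows and hence the
    -- whole class.
    α-onto : ∀ a → ∃ λ j → j < M × α j ≡ a
    α-onto a = let i , e = injective⇒surjective {f = α ∘ toℕ} inj a in toℕ i , toℕ<n i , e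
      where
      inj : Injective _≡_ _≡_ (α ∘ toℕ)
      inj {i} {j} e = toℕ-injective (*-cancelʳ-≡ (toℕ i) (toℕ j) k
        (at-inj (j*k<n (toℕ<n i)) (j*k<n (toℕ<n j)) (at-+-cancelˡ P
          (trans (sym (α-start (toℕ<n i))) (trans (cong (at ∘ start) e) (α-start (toℕ<n j)))))))

    -- The bit which the class writes at position P + u; the positions P and P + n, which
    -- coincide, are the two copies of the overlap.
    letterAt : ℕ → Bool
    letterAt u = bit (proj₂ (vertex (α (u / k)))) (u % k)

    letterAt-jk+t : ∀ j {t} → t < k → letterAt (j * k + t) ≡ bit (proj₂ (vertex (α j))) t
    letterAt-jk+t j {t} t<k = cong₂ (λ q r → bit (proj₂ (vertex (α q))) r)
      (trans (cong (_/ k) (+-comm (j * k) t)) (trans (+-distrib-/-∣ʳ t (n∣m*n j))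
        (cong₂ _+_ (m<n⇒m/n≡0 t<k) (m*n/n≡m j k))))
      (trans (cong (_% k) (+-comm (j * k) t)) (trans ([m+kn]%n≡m%n t j k) (m<n⇒m%n≡m t<k)))

    -- The representative of q - P, as `N * P` is -P modulo `n`.
    offset : Fin n → ℕ
    offset q = toℕ (at (toℕ q + N * P))

    -- The reflection below exchanges the positions P + u and P + n - u; a toggle is required
    -- exactly where their bits differ.
    mismatch : Fin n → Bool
    mismatch q = letterAt (offset q) xor letterAt (n ∸ offset q)

    mismatch-at : ∀ {u} → u ≤ n → mismatch (at (P + u)) ≡ letterAt u xor letterAt (n ∸ u)
    mismatch-at {u} u≤n with m≤n⇒m<n∨m≡n u≤n
    ... | inj₁ u<n  = cong (λ u → letterAt u xor letterAt (n ∸ u)) (trans (offset-at u) (toℕ-at-< u<n))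
      where
      offset-at : ∀ u → offset (at (P + u)) ≡ toℕ (at u)
      offset-at u = cong toℕ (trans (at-toℕ-at-+ (P + u) (N * P)) (trans (cong at (regroup N P u)) (at-+*n u P)))
        where
        regroup : ∀ N P u → P + u + N * P ≡ u + P * suc N
        regroup = solve-∀
    -- The position P + n has offset 0, not `n`. The symmetry of xor under exchanging u and n - u
    -- keeps the two copies of the overlap consistent.
    ... | inj₂ refl = trans (cong (λ u → letterAt u xor letterAt (n ∸ u)) offset-n)
      (trans (xor-comm (letterAt 0) (letterAt n)) (cong (λ u → letterAt n xor letterAt u) (sym (n∸n≡0 n))))
      where
      regroup : ∀ N P → P + suc N + N * P ≡ 0 + suc P * suc N
      regroup = solve-∀
      offset-n : offset (at (P + n)) ≡ 0
      offset-n = trans (cong toℕ (trans (at-toℕ-at-+ (P + n) (N * P)) (trans (cong at (regroup N P)) (at-+*n 0 (suc P)))))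
        (toℕ-at-< z<s)

    module Reflected (M′ : ℕ) (M≡ : M ≡ suc M′) where

      σ : Automorphism (PX n k)
      -- With this constant the starts P + jk and P + j′k are exchanged whenever j + j′ = M′.
      σ = reflectFlipAut (P + P + M′ * k) mismatch

      f : Vertex → Vertex
      f = Inverse.to (perm σ)

      bounded : ∀ {j j′} → j + j′ ≡ M′ → j < M
      bounded {j} {j′} e = subst (j <_) (sym M≡) (s≤s (subst (j ≤_) e (m≤m+n j j′)))

      -- Xor with `mismatch` replaces the bit at offset u by the bit at n - u. Reversing the word
      -- matches it with window `j′`, as the two offsets add up to M′k + m = n.
      f-vertex : ∀ {j j′} → j + j′ ≡ M′ → f (vertex (α j)) ≡ vertex (α j′)
      f-vertex {j} {j′} e = cong₂ _,_ layer-≡ (bit-ext _ _ bit-≡)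
        where
        v  = vertex (α j)
        w  = vertex (α j′)
        Pj  = α-start (bounded e)
        Pj′ = α-start (bounded (trans (+-comm j′ j) e))
        layer-≡ : proj₁ (f v) ≡ proj₁ w
        layer-≡ = trans (sym (at-toℕ _)) (trans (at-+-cancelˡ (start (α j)) (begin
          at (start (α j) + toℕ (proj₁ (f v)))   ≡⟨ reflect-layer (P + P + M′ * k) (flip mismatch v) ⟩
          at (P + P + M′ * k)                    ≡⟨ cong (λ M′ → at (P + P + M′ * k)) e ⟨
          at (P + P + (j + j′) * k)              ≡⟨ cong at (regroup P j j′ k) ⟩
          at (P + j * k + (P + j′ * k))          ≡⟨ at-+-cong Pj Pj′ ⟨
          at (start (α j) + start (α j′))        ∎)) (at-toℕ _))
          where
          open ≡-Reasoning
          regroup : ∀ P j j′ k → P + P + (j + j′) * k ≡ P + j * k + (P + j′ * k)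
          regroup = solve-∀
        bit-≡ : ∀ t → t < k → bit (proj₂ (f v)) t ≡ bit (proj₂ w) t
        bit-≡ t t<k = begin
          bit (proj₂ (f v)) t                                   ≡⟨ reflect-bit (P + P + M′ * k) (flip mismatch v) t<k ⟩
          bit (proj₂ (flip mismatch v)) s                       ≡⟨ flip-bit mismatch v s<k ⟩
          bit (proj₂ v) s xor mismatch (at (start (α j) + s))   ≡⟨ cong₂ (λ b p → b xor mismatch p) (sym (letterAt-jk+t j s<k)) position ⟩
          letterAt u xor mismatch (at (P + u))                  ≡⟨ cong (letterAt u xor_) (mismatch-at u≤n) ⟩
          letterAt u xor (letterAt u xor letterAt (n ∸ u))      ≡⟨ xor-assoc (letterAt u) _ _ ⟨
          (letterAt u xor letterAt u) xor letterAt (n ∸ u)      ≡⟨ cong (_xor letterAt (n ∸ u)) (xor-same (letterAt u)) ⟩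
          letterAt (n ∸ u)                                      ≡⟨ cong letterAt (trans (cong (_∸ u) (sym u+u′≡n)) (m+n∸m≡n u (j′ * k + t))) ⟩
          letterAt (j′ * k + t)                                 ≡⟨ letterAt-jk+t j′ t<k ⟩
          bit (proj₂ w) t                                       ∎
          where
          open ≡-Reasoning
          s = m ∸ t
          u = j * k + s
          s<k : s < k
          s<k = s≤s (m∸n≤m m t)
          position : at (start (α j) + s) ≡ at (P + u)
          position = trans (at-+-cong {start (α j)} {P + j * k} {s} Pj refl) (cong at (+-assoc P (j * k) s))
          regroup : ∀ j j′ k s t → suc (j * k + s + (j′ * k + t)) ≡ suc (s + t) + (j + j′) * k
          regroup = solve-∀
          u+u′≡n : u + (j′ * k + t) ≡ n
          u+u′≡n = suc-injective (trans (regroup j j′ k s t)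
            (trans (cong₂ (λ m M′ → suc m + M′ * k) (m∸n+n≡m (s≤s⁻¹ t<k)) e)
              (trans (cong (_* k) (sym M≡)) (sym 1+n≡Mk))))
          u≤n : u ≤ n
          u≤n = subst (u ≤_) u+u′≡n (m≤m+n u (j′ * k + t))

      mirror : ∀ {v} → c v ≡ b → Σ ℕ λ j → Σ ℕ λ j′ → j + j′ ≡ M′ × vertex (α j) ≡ v
      mirror {v} e with vertex-onto e
      ... | a , refl with α-onto a
      ...   | j , j<M , refl = j , M′ ∸ j , m+[n∸m]≡n (s≤s⁻¹ (subst (j <_) M≡ j<M)) , refl

      f-preserves : ∀ v → c (f v) ≡ c v
      f-preserves = class-preserved⇒color-preserved c b f to from
        where
        to : ∀ {v} → c v ≡ b → c (f v) ≡ b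
        to e with mirror e
        ... | j , j′ , e′ , refl = trans (cong c (f-vertex e′)) (vertex-color (α j′))
        from : ∀ {v} → c (f v) ≡ b → c v ≡ b
        from {v} e with mirror e
        ... | j , j′ , e′ , w = trans (cong c v≡) (vertex-color (α j′))
          where
          v≡ : v ≡ vertex (α j′)
          v≡ = automorphism-injective σ (trans (sym w) (sym (f-vertex (trans (+-comm j′ j) e′))))

      -- `σ` preserves the colouring, hence is the identity; yet it moves the first window to the
      -- last, which starts `M′ * k` later, a nonzero distance below `n`.
      impossible : 1 ≤ M′ → ⊥
      impossible 1≤M′ = <⇒≢ (*-mono-≤ 1≤M′ (s≤s (z≤n {m}))) (sym (at-+-absorb P (j*k<n (bounded {M′} {0} (+-identityʳ M′))) (begin
        at (P + M′ * k)     ≡⟨ α-start (bounded {M′} {0} (+-identityʳ M′)) ⟨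
        at (start (α M′))   ≡⟨ cong (at ∘ toℕ ∘ proj₁) (f-vertex {0} {M′} refl) ⟨
        at (toℕ (proj₁ (f (vertex (α 0))))) ≡⟨ cong (at ∘ toℕ ∘ proj₁) (dist σ f-preserves (vertex (α 0))) ⟩
        at (start (α 0))    ≡⟨ α-start (bounded {0} {M′} refl) ⟩
        at (P + 0)          ≡⟨ cong at (+-identityʳ P) ⟩
        at P                ∎)))
        where open ≡-Reasoning

  no-tight-coloring : ⊥
  no-tight-coloring with m≤n⇒∃[o]m+o≡n 2≤M | end-overlap
  ... | o , e | _ , _ , ends = let α , α-start = Progression.progression-function ends in
    Arranged.Reflected.impossible _ α (λ {j} → α-start {j}) (suc o) (sym e) (s≤s z≤n)

-- Assembly of the two bounds.

theorem6p5 : (n k : ℕ) → 2 ≤ k → 2 * k < n → ¬ (k ∣ n) →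
    ((k ∣ suc n) → IsRho (PX n k) (⌈ n / k ⌉ + 1))
    × (¬ (k ∣ suc n) → IsRho (PX n k) ⌈ n / k ⌉)
theorem6p5 (suc N) (suc m) (s≤s 1≤m) 2k<n k∤n = minusOne , otherwise
  where
  n = suc N
  k = suc m
  M = ⌈ n / k ⌉
  -- The excess of `M * k` over `n`: the ceiling is `(n + m) / k`, so `M * k` is `n + m` less its
  -- remainder.
  r = m ∸ (n + m) % k

  n+r≡Mk : n + r ≡ M * k
  n+r≡Mk = +-cancelʳ-≡ t _ _ (begin
    n + r + t         ≡⟨ +-assoc n r t ⟩
    n + (r + t)       ≡⟨ cong (n +_) (m∸n+n≡m (s≤s⁻¹ (m%n<n (n + m) k))) ⟩
    n + m             ≡⟨ m≡m%n+[m/n]*n (n + m) k ⟩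
    t + M * k         ≡⟨ +-comm t (M * k) ⟩
    M * k + t         ∎)
    where
    open ≡-Reasoning
    t = (n + m) % k

  r<k : r < k
  r<k = s≤s (m∸n≤m m ((n + m) % k))

  2≤M : 2 ≤ M
  2≤M = *-cancelʳ-≤ 2 M k (≤-trans (<⇒≤ 2k<n) (≤-trans (m≤m+n n r) (≤-reflexive n+r≡Mk)))

  4<n : 4 < n
  4<n = ≤-<-trans (*-monoʳ-≤ 2 (s≤s 1≤m)) 2k<n

  M≤s : ∀ c → Distinguishing (PX n k) c → ∀ b s → ClassSize (PX n k) c b s → M ≤ s
  M≤s c dist b s size = s≤s⁻¹ (m<n*o⇒m/o<n {n + m} {suc s} {k} (begin-strict
    n + m       <⟨ +-monoʳ-< n (n<1+n m) ⟩
    n + k       ≤⟨ +-monoˡ-≤ k (Flips.ColorClass.n≤s*k N m c dist b size) ⟩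
    s * k + k   ≡⟨ +-comm (s * k) k ⟩
    suc s * k   ∎))
    where open ≤-Reasoning

  k∣n+r : k ∣ n + r
  k∣n+r = divides M n+r≡Mk

  minusOne : k ∣ suc n → IsRho (PX n k) (M + 1)
  minusOne k∣1+n with r in r≡
  ... | zero = ⊥-elim (k∤n (subst (k ∣_) (trans (cong (n +_) r≡) (+-identityʳ n)) k∣n+r))
  -- `k` divides both `n + r` and `suc n`, hence their difference r - 1, which is positive and below
  -- `k`.
  ... | suc (suc r″) = ⊥-elim (<⇒≱ (subst (_< k) r≡ r<k) (≤-trans (∣⇒≤ {suc r″} {k} (∣m+n∣m⇒∣n
          (subst (k ∣_) (trans (cong (n +_) r≡) (+-suc n (suc r″))) k∣n+r) k∣1+n)) (n≤1+n (suc r″))))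
  ... | suc zero = subst (IsRho (PX n k)) (+-comm 1 M)
    ( Existence.exists-1+M N m M 0 n+1≡Mk (s≤s 1≤m) 2≤M 4<n refl
    -- The covering bound gives `M ≤ s`, and equality is the tight case just excluded.
    , λ c dist b s size → ≤∧≢⇒< (M≤s c dist b s size) λ { refl →
        Tight.no-tight-coloring N m M (trans (+-comm 1 n) n+1≡Mk) 1≤m 2≤M 4<n c dist b size })
    where
    n+1≡Mk : n + 1 ≡ M * k
    n+1≡Mk = trans (cong (n +_) (sym r≡)) n+r≡Mk

  otherwise : ¬ (k ∣ suc n) → IsRho (PX n k) M
  otherwise k∤1+n with r in r≡
  ... | zero = ⊥-elim (k∤n (subst (k ∣_) (trans (cong (n +_) r≡) (+-identityʳ n)) k∣n+r))
  ... | suc r′ = Existence.exists-M N m M r′ (trans (cong (n +_) (sym r≡)) n+r≡Mk)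
      (subst (_< k) r≡ r<k) 2≤M 4<n
      (λ { refl → k∤1+n (subst (k ∣_) (trans (cong (n +_) r≡) (+-comm n 1)) k∣n+r) })
    , M≤s
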